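{- The following are equivalent: (1) Vopěnka's principle. (2) For every signature $\Sigma$ and every assignment, to each $\Sigma$-structure $M$, of a subset $S^M\subseteq |M|$ which is preserved by all homomorphisms (i.e. $f(S^M)\subseteq S^N$ for every homomorphism $f:M\to N$ of $\Sigma$-structures), the subsets $S^M$ are definable by an infinitary coherent formula: there are cardinals $\kappa,\lambda$ and a formula $\phi(x)$ of the form $\bigvee_{j<\lambda}\exists_{i<\kappa}x_i\bigwedge_{i<\kappa}\psi_i^j$, with each $\psi_i^j$ an atomic formula, such that $[[\phi]]^M=S^M$ for all $\Sigma$-structures $M$.
   Context: Vopěnka's principle: for every proper class of structures in a common signature (equivalently, of graphs) there exist two distinct members $A\neq B$ of the class and a homomorphism $A\to B$; equivalently, no locally presentable category contains a large full discrete (rigid) subcategory. $[[\phi]]^M$ denotes the set of elements of $M$ satisfying $\phi$. -}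

module Defs where

open import Axiom.ExcludedMiddle using (ExcludedMiddle)
open import Axiom.Extensionality.Propositional using (Extensionality)
open import Data.Bool using (Bool; T)
open import Data.Fin using (Fin)
open import Data.Maybe using (Maybe; maybe′)
open import Data.Nat using (ℕ)
open import Data.Product using (Σ-syntax; ∃-syntax; _×_)
open import Data.Vec.Functional using (Vector; map)
open import Level using (Level; Setω; Lift; suc)
open import Relation.Binary.PropositionalEquality using (_≡_; _≢_)
open import Relation.Nullary using (¬_)
open import Relation.Unary using (Pred; _∈_; _≐_)

-- The result is one of classical set theory.  Sets are the types in `Set ℓ`,
-- for an arbitrary ℓ, and classes are predicates on types in `Set (suc ℓ)`.
-- The classical background is an explicit assumption; since `Dec P` carries an
-- element of P whenever there is one, excluded middle also provides choice.

record Classical : Setω where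
  field
    excludedMiddle : ∀ {a} → ExcludedMiddle a
    extensionality : ∀ {a b} → Extensionality a b

record Signature (ℓ : Level) : Set (suc ℓ) where
  field
    Func      : Set ℓ
    Rel       : Set ℓ
    funcArity : Func → ℕ
    relArity  : Rel → ℕ

open Signature public

-- Relations are Bool-valued, so that they are extensional like subsets of
-- a power Mⁿ.  Type-valued relations could be distinct while holding of the
-- same tuples, which would interfere with "distinct members" of a class and
-- with the size of a class.

record Structure {ℓ} (S : Signature ℓ) : Set (suc ℓ) where
  field
    ∣_∣  : Set ℓ
    func : (f : Func S) → Vector ∣_∣ (funcArity S f) → ∣_∣
    rel  : (r : Rel S) → Vector ∣_∣ (relArity S r) → Bool

open Structure public

record Hom {ℓ} {S : Signature ℓ} (M N : Structure S) : Set ℓ where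
  field
    apply         : ∣ M ∣ → ∣ N ∣
    preservesFunc : ∀ f xs → apply (func M f xs) ≡ func N f (map apply xs)
    preservesRel  : ∀ r xs → T (rel M r xs) → T (rel N r (map apply xs))

open Hom public

-- By replacement and separation, the classes that are sets are exactly the
-- images of set-indexed families.

IsSet : ∀ {ℓ} {U : Set (suc ℓ)} → Pred U (suc ℓ) → Set (suc ℓ)
IsSet {ℓ} {U} C = Σ[ I ∈ Set ℓ ] Σ[ u ∈ (I → U) ] C ≐ (λ A → ∃[ i ] u i ≡ A)

ProperClass : ∀ {ℓ} {U : Set (suc ℓ)} → Pred U (suc ℓ) → Set (suc ℓ)
ProperClass C = ¬ IsSet C

VopěnkaPrinciple : ∀ ℓ → Set (suc (suc ℓ))
VopěnkaPrinciple ℓ =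
  (S : Signature ℓ) (C : Pred (Structure S) (suc ℓ)) → ProperClass C →
  ∃[ A ] ∃[ B ] A ∈ C × B ∈ C × A ≢ B × Hom A B

data Term {ℓ} (S : Signature ℓ) (X : Set ℓ) : Set ℓ where
  var : X → Term S X
  app : (f : Func S) → Vector (Term S X) (funcArity S f) → Term S X

data Atomic {ℓ} (S : Signature ℓ) (X : Set ℓ) : Set ℓ where
  equation : Term S X → Term S X → Atomic S X
  relation : (r : Rel S) → Vector (Term S X) (relArity S r) → Atomic S X

module _ {ℓ} {S : Signature ℓ} (M : Structure S) {X : Set ℓ} (ρ : X → ∣ M ∣) where

  eval : Term S X → ∣ M ∣
  eval (var x)    = ρ x
  eval (app f ts) = func M f (λ i → eval (ts i))

  Satisfies : Atomic S X → Set ℓ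
  Satisfies (equation s t)  = eval s ≡ eval t
  Satisfies (relation r ts) = Lift ℓ (T (rel M r (λ i → eval (ts i))))

-- The formula ⋁_{j<λ} ∃_{i<κ} xᵢ ⋀_{i<κ} ψᵢʲ with free variable x.  The cardinals
-- κ and λ are given by arbitrary sets of these sizes.  In `Maybe κ`, `nothing`
-- is the variable x and `just i` is the variable xᵢ.

record CoherentFormula {ℓ} (S : Signature ℓ) : Set (suc ℓ) where
  field
    κ : Set ℓ
    Λ : Set ℓ
    ψ : Λ → κ → Atomic S (Maybe κ)

⟦_⟧ : ∀ {ℓ} {S : Signature ℓ} → CoherentFormula S →
      (M : Structure S) → Pred ∣ M ∣ ℓ
⟦ φ ⟧ M a = ∃[ j ] Σ[ b ∈ (κ → ∣ M ∣) ] (∀ i → Satisfies M (maybe′ b a) (ψ j i))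
  where open CoherentFormula φ

SubsetAssignment : ∀ {ℓ} → Signature ℓ → Set (suc ℓ)
SubsetAssignment {ℓ} S = (M : Structure S) → Pred ∣ M ∣ ℓ

PreservedByHoms : ∀ {ℓ} {S : Signature ℓ} → SubsetAssignment S → Set (suc ℓ)
PreservedByHoms P = ∀ {M N} (h : Hom M N) {x} → x ∈ P M → apply h x ∈ P N

CoherentlyDefinable : ∀ {ℓ} {S : Signature ℓ} → SubsetAssignment S → Set (suc ℓ)
CoherentlyDefinable {S = S} P =
  Σ[ φ ∈ CoherentFormula S ] (∀ M → ⟦ φ ⟧ M ≐ P M)

PreservedSubsetsDefinable : ∀ ℓ → Set (suc ℓ)
PreservedSubsetsDefinable ℓ =
  (S : Signature ℓ) (P : SubsetAssignment S) →
  PreservedByHoms P → CoherentlyDefinable P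

{-# OPTIONS --safe #-}

-- (2) ⇒ (1).  Let C be a class without homomorphisms between distinct members, and
-- let P M be all of M if some member of C maps to M, and empty otherwise.  If the same
-- disjunct of a formula defining P is satisfied in two members A and B of C, then it is
-- satisfied in A × B, so some member of C maps to A × B and hence equals both A and B.
-- Thus the inhabited members of C are no more than the disjuncts.  The empty ones are
-- determined by their nullary relations, so C is a set.
--
-- (1) ⇒ (2).  If a set of pairs (Mᵢ , aᵢ) with aᵢ ∈ P Mᵢ is weakly initial among all
-- such pairs, the disjunction of their diagrams defines P.  Otherwise there are pairs
-- (M_α , a_α), one for each ordinal α, such that (M_α , a_α) receives no homomorphism
-- from an earlier pair.  Adjoin α with its strict order to M_α: a homomorphism of
-- the resulting structures increases ordinals weakly, so none exists between
-- distinct ones, contrary to Vopěnka's principle.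
module Submission where

open import Defs
open import Function.Bundles using (_⇔_; mk⇔; module Equivalence)

open import Data.Bool using (Bool; T; _∧_)
open import Data.Bool.Properties using (T-∧)
open import Data.Empty using (⊥-elim)
open import Data.Empty.Polymorphic using (⊥)
open import Data.Fin using (Fin; zero)
open import Data.Maybe using (Maybe; just; nothing; maybe′)
open import Data.Nat using (ℕ)
open import Data.Product using (Σ-syntax; ∃-syntax; _×_; _,_; proj₁; proj₂)
open import Data.Sum using (_⊎_; inj₁; inj₂)
open import Data.Sum.Properties using (inj₁-injective; inj₂-injective)
open import Data.Vec.Functional using (Vector; map; []; _∷_)
open import Function using (_∘_; id; const)
open import Level using (Level; Lift; lift; lower; suc)
open import Relation.Binary.PropositionalEquality
  using (_≡_; refl; sym; trans; cong; cong₂; cong-app; subst)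
open import Relation.Nullary using (¬_; yes; no; contradiction)
open import Relation.Nullary.Decidable
  using (isYes; isYes≗does; does-⇔; toWitness; fromWitness; decidable-stable)
open import Relation.Unary using (Pred; _∈_)

-- Homomorphisms, binary products and marked elements.

idHom : ∀ {ℓ} {S : Signature ℓ} {M : Structure S} → Hom M M
idHom = record { apply = id ; preservesFunc = λ _ _ → refl ; preservesRel = λ _ _ → id }

_∘ʰ_ : ∀ {ℓ} {S : Signature ℓ} {L M N : Structure S} → Hom M N → Hom L M → Hom L N
g ∘ʰ f = record
  { apply         = apply g ∘ apply f
  ; preservesFunc = λ s xs →
      trans (cong (apply g) (preservesFunc f s xs)) (preservesFunc g s _)
  ; preservesRel  = λ r xs → preservesRel g r _ ∘ preservesRel f r xs
  }

module _ {ℓ} {S : Signature ℓ} where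

  _×ˢ_ : Structure S → Structure S → Structure S
  M ×ˢ N = record
    { ∣_∣  = ∣ M ∣ × ∣ N ∣
    ; func = λ f xs → func M f (proj₁ ∘ xs) , func N f (proj₂ ∘ xs)
    ; rel  = λ r xs → rel M r (proj₁ ∘ xs) ∧ rel N r (proj₂ ∘ xs)
    }

  π₁ : ∀ {M N} → Hom (M ×ˢ N) M
  π₁ = record
    { apply         = proj₁
    ; preservesFunc = λ _ _ → refl
    ; preservesRel  = λ _ _ → proj₁ ∘ Equivalence.to T-∧
    }

  π₂ : ∀ {M N} → Hom (M ×ˢ N) N
  π₂ = record
    { apply         = proj₂
    ; preservesFunc = λ _ _ → refl
    ; preservesRel  = λ _ _ → proj₂ ∘ Equivalence.to T-∧
    }

  DisjunctHolds : (φ : CoherentFormula S) → CoherentFormula.Λ φ →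
                  (M : Structure S) → Pred ∣ M ∣ ℓ
  DisjunctHolds φ j M a =
    Σ[ b ∈ (CoherentFormula.κ φ → ∣ M ∣) ]
      (∀ i → Satisfies M (maybe′ b a) (CoherentFormula.ψ φ j i))

  Element : SubsetAssignment S → Set (suc ℓ)
  Element P = Σ[ M ∈ Structure S ] ∃[ a ] a ∈ P M

  ElementHom : (P : SubsetAssignment S) → Element P → Element P → Set ℓ
  ElementHom P (M , a , _) (N , b , _) = Σ[ h ∈ Hom M N ] apply h a ≡ b

-- Ordinals as well-founded trees.

data Ordinal (ℓ : Level) : Set (suc ℓ) where
  -- The least ordinal strictly above all values of the family.
  sup : {I : Set ℓ} → (I → Ordinal ℓ) → Ordinal ℓ

module _ {ℓ : Level} where

  infix 4 _≤_ _<_ _≈_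

  _≤_ : Ordinal ℓ → Ordinal ℓ → Set ℓ
  sup f ≤ sup g = ∀ i → ∃[ j ] f i ≤ g j

  _<_ : Ordinal ℓ → Ordinal ℓ → Set ℓ
  α < sup g = ∃[ j ] α ≤ g j

  -- Different trees may present one ordinal, so this relation, not `≡`, is equality of ordinals.
  _≈_ : Ordinal ℓ → Ordinal ℓ → Set ℓ
  α ≈ β = α ≤ β × β ≤ α

  sup-least : ∀ {I : Set ℓ} {f : I → Ordinal ℓ} β → (∀ i → f i < β) → sup f ≤ β
  sup-least (sup g) p = p

  ≤-refl : ∀ α → α ≤ α
  ≤-refl (sup f) i = i , ≤-refl (f i)

  ≤-trans : ∀ {α β γ} → α ≤ β → β ≤ γ → α ≤ γ
  ≤-trans {sup f} {sup g} {sup h} p q i =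
    let j , p′ = p i
        k , q′ = q j
    in k , ≤-trans p′ q′

  ≤-<-trans : ∀ {α β γ} → α ≤ β → β < γ → α < γ
  ≤-<-trans {γ = sup h} p (k , q) = k , ≤-trans p q

  <-≤-trans : ∀ {α β γ} → α < β → β ≤ γ → α < γ
  <-≤-trans {β = sup g} {sup h} (j , p) q =
    let k , q′ = q j in k , ≤-trans p q′

  <-irrefl : ∀ {α} → ¬ (α < α)
  <-irrefl {sup f} (i , p) =
    <-irrefl {f i} (<-≤-trans {β = sup f} (i , ≤-refl (f i)) p)

  <⇒≤ : ∀ {α β} → α < β → α ≤ β
  <⇒≤ {sup f} {sup g} (j , p) i =
    j , <⇒≤ (<-≤-trans {β = sup f} (i , ≤-refl (f i)) p)

  ≈-sym : ∀ {α β} → α ≈ β → β ≈ α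
  ≈-sym (p , q) = q , p

  ≈-trans : ∀ {α β γ} → α ≈ β → β ≈ γ → α ≈ γ
  ≈-trans (p , q) (p′ , q′) = ≤-trans p p′ , ≤-trans q′ q

  mutual

    -- Positions in the tree, with `nothing` for the root. Through `subtree` they index the ordinals
    -- up to `α`, with repetitions, by a small set, whereas `Ordinal ℓ` is large.
    Node : Ordinal ℓ → Set ℓ
    Node α = Maybe (ProperNode α)

    ProperNode : Ordinal ℓ → Set ℓ
    ProperNode (sup {I} f) = Σ[ i ∈ I ] Node (f i)

  subtree : ∀ α → Node α → Ordinal ℓ
  subtree α       nothing        = α
  subtree (sup f) (just (i , s)) = subtree (f i) s

  subtree-≤ : ∀ α s → subtree α s ≤ α
  subtree-≤ α       nothing        = ≤-refl α
  subtree-≤ (sup f) (just (i , s)) = <⇒≤ (i , subtree-≤ (f i) s)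

  -- A strictly increasing map of ordinals never moves one down: by induction `e` sends the root of
  -- each `f i` to at least `f i`, and `e nothing` is strictly above all these values.
  ≤-monotone-root : ∀ α (e : Node α → Ordinal ℓ) →
    (∀ s t → subtree α s < subtree α t → e s < e t) → α ≤ e nothing
  ≤-monotone-root (sup f) e mono = sup-least (e nothing) λ i →
    ≤-<-trans (≤-monotone-root (f i) (e ∘ just ∘ (i ,_)) (λ _ _ → mono _ _))
              (mono (just (i , nothing)) nothing (i , ≤-refl (f i)))

-- The relational signature for adjoining an ordinal.

module _ {ℓ} (S : Signature ℓ) where

  -- Operations become graphs, so they need no values at ordinal nodes; `element` and `node` keep
  -- homomorphisms from mixing the two sorts.
  data Symbol : Set ℓ where
    element point node order : Symbol
    graph                    : Func S → Symbol
    original                 : Rel S → Symbol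

  expandedSignature : Signature ℓ
  expandedSignature = record
    { Func = ⊥ ; Rel = Symbol ; funcArity = λ () ; relArity = arity }
    where
    arity : Symbol → ℕ
    arity element      = 1
    arity point        = 1
    arity node         = 1
    arity order        = 2
    arity (graph f)    = ℕ.suc (funcArity S f)
    arity (original r) = relArity S r

-- Truth values, choice and smallness from excluded middle.

module _ (classical : Classical) where
  open Classical classical

  -- `T (holds A)` is small even if `A` quantifies over a large type, and equivalent propositions
  -- get equal truth values.
  holds : ∀ {a} → Set a → Bool
  holds A = isYes (excludedMiddle {P = A})

  holds⁺ : ∀ {a} {A : Set a} → A → T (holds A)
  holds⁺ = fromWitness

  holds⁻ : ∀ {a} {A : Set a} → T (holds A) → A
  holds⁻ = toWitness

  holds-cong : ∀ {a b} {A : Set a} {B : Set b} → A ⇔ B → holds A ≡ holds B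
  holds-cong A⇔B = trans (isYes≗does excludedMiddle)
    (trans (does-⇔ A⇔B excludedMiddle excludedMiddle) (sym (isYes≗does excludedMiddle)))

  byContradiction : ∀ {a} {A : Set a} → ¬ ¬ A → A
  byContradiction = decidable-stable excludedMiddle

  -- The predicate is Boolean so that, by extensionality, equivalent predicates yield the same
  -- choice.
  choose : ∀ {a} {A : Set a} → A → (A → Bool) → A
  choose x₀ p with excludedMiddle {P = ∃[ x ] T (p x)}
  ... | yes (x , _) = x
  ... | no  _       = x₀

  choose-satisfies : ∀ {a} {A : Set a} (x₀ : A) (p : A → Bool) →
                     ∃[ x ] T (p x) → T (p (choose x₀ p))
  choose-satisfies x₀ p x∈p with excludedMiddle {P = ∃[ x ] T (p x)}
  ... | yes (_ , px) = px
  ... | no  ∄x       = contradiction x∈p ∄x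

  -- The codes that occur form a set; a member chosen for each of them is the only one with that
  -- code.
  isSet-coded : ∀ {ℓ a} {U : Set (suc ℓ)} {C : Pred U (suc ℓ)} {J : Set ℓ}
    (Code : U → J → Set a) →
    (∀ {A} → A ∈ C → ∃[ j ] Code A j) →
    (∀ {A B j} → A ∈ C → B ∈ C → Code A j → Code B j → A ≡ B) →
    IsSet C
  isSet-coded {C = C} {J} Code total injective =
    (Σ[ j ∈ J ] T (holds (Coded j))) ,
    (λ (_ , t) → proj₁ (holds⁻ t)) ,
    (λ A∈C →
      let j , c = total A∈C
          t : T (holds (Coded j))
          t = holds⁺ (_ , A∈C , c)
          _ , B∈C , c′ = holds⁻ t
      in (j , t) , injective B∈C A∈C c′ c) ,
    λ { ((_ , t) , refl) → proj₁ (proj₂ (holds⁻ t)) }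
    where
    Coded : J → Set _
    Coded j = ∃[ A ] A ∈ C × Code A j

  -- Formulas in products, and homomorphisms of empty structures.

  module _ {ℓ} {S : Signature ℓ} where

    eval-hom : ∀ {M N : Structure S} (h : Hom M N) {X : Set ℓ} (ρ : X → ∣ M ∣) t →
               apply h (eval M ρ t) ≡ eval N (apply h ∘ ρ) t
    eval-hom h ρ (var x)            = refl
    eval-hom {N = N} h ρ (app f ts) = trans (preservesFunc h f _)
      (cong (func N f) (extensionality λ i → eval-hom h ρ (ts i)))

    -- The projections are homomorphisms, so terms in the product evaluate componentwise.
    satisfies-× : ∀ {M N : Structure S} {X : Set ℓ} (ρ : X → ∣ M ∣) (σ : X → ∣ N ∣) ψ →
      Satisfies M ρ ψ → Satisfies N σ ψ → Satisfies (M ×ˢ N) (λ x → ρ x , σ x) ψ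
    satisfies-× {M} {N} ρ σ (equation s t) p q = cong₂ _,_
      (trans (eval-hom (π₁ {M = M} {N}) _ s) (trans p (sym (eval-hom (π₁ {M = M} {N}) _ t))))
      (trans (eval-hom (π₂ {M = M} {N}) _ s) (trans q (sym (eval-hom (π₂ {M = M} {N}) _ t))))
    satisfies-× {M} {N} ρ σ (relation r ts) (lift p) (lift q) =
      lift (Equivalence.from T-∧
        ( subst (T ∘ rel M r) (extensionality λ i → sym (eval-hom (π₁ {M = M} {N}) _ (ts i))) p
        , subst (T ∘ rel N r) (extensionality λ i → sym (eval-hom (π₂ {M = M} {N}) _ (ts i))) q))

    disjunct-× : ∀ φ j {M N : Structure S} {a b} →
      DisjunctHolds φ j M a → DisjunctHolds φ j N b → DisjunctHolds φ j (M ×ˢ N) (a , b)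
    disjunct-× φ j {M} {N} {a} {b} (ρ , p) (σ , q) = (λ x → ρ x , σ x) , λ i →
      subst (λ τ → Satisfies (M ×ˢ N) τ (CoherentFormula.ψ φ j i)) pairing
        (satisfies-× (maybe′ ρ a) (maybe′ σ b) _ (p i) (q i))
      where
      pairing : (λ x → maybe′ ρ a x , maybe′ σ b x) ≡ maybe′ (λ x → ρ x , σ x) (a , b)
      pairing = extensionality λ { (just _) → refl ; nothing → refl }

    -- For an empty structure this records which nullary relations hold.
    relationsInhabited : Structure S → Rel S → Bool
    relationsInhabited M r = holds (∃[ xs ] T (rel M r xs))

    homBetweenEmpty : {M N : Structure S} → ¬ ∣ M ∣ → ¬ ∣ N ∣ →
      relationsInhabited M ≡ relationsInhabited N → Hom M N
    homBetweenEmpty {M} {N} M-empty N-empty eq = record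
      { apply         = h
      ; preservesFunc = λ f xs → ⊥-elim (M-empty (func M f xs))
      ; preservesRel  = λ r xs t →
          let ys , t′ = holds⁻ (subst T (cong-app eq r) (holds⁺ (xs , t)))
          -- An index `i` would give an element `ys i` of the empty `N`, so the arity is zero and
          -- the tuples agree.
          in subst (T ∘ rel N r) (extensionality λ i → ⊥-elim (N-empty (ys i))) t′
      }
      where
      h : ∣ M ∣ → ∣ N ∣
      h x = ⊥-elim (M-empty x)

  -- From definability to Vopěnka's principle.

  definable⇒vopěnka : ∀ {ℓ} → PreservedSubsetsDefinable ℓ → VopěnkaPrinciple ℓ
  definable⇒vopěnka {ℓ} definable S C proper = byContradiction λ discrete →
    proper (isSet-coded Code code (injective discrete))
    where
    P : SubsetAssignment S
    P M _ = Lift ℓ (T (holds (∃[ A ] A ∈ C × Hom A M)))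

    P-preserved : PreservedByHoms P
    P-preserved h (lift t) =
      let A , A∈C , g = holds⁻ t in lift (holds⁺ (A , A∈C , h ∘ʰ g))

    φ : CoherentFormula S
    φ = proj₁ (definable S P P-preserved)

    φ-defines : ∀ M → (∀ {a} → a ∈ ⟦ φ ⟧ M → a ∈ P M) × (∀ {a} → a ∈ P M → a ∈ ⟦ φ ⟧ M)
    φ-defines = proj₂ (definable S P P-preserved)

    -- A formula with a free variable says nothing about an empty structure, so empty members need
    -- codes of their own.
    Code : Structure S → CoherentFormula.Λ φ ⊎ (Rel S → Bool) → Set ℓ
    Code A (inj₁ j) = ∃[ a ] DisjunctHolds φ j A a
    Code A (inj₂ c) = ¬ ∣ A ∣ × relationsInhabited A ≡ c

    code : ∀ {A} → A ∈ C → ∃[ j ] Code A j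
    code {A} A∈C with excludedMiddle {P = ∣ A ∣}
    ... | no  empty = inj₂ _ , empty , refl
    ... | yes a     =
      let j , p = proj₂ (φ-defines A) {a} (lift (holds⁺ (A , A∈C , idHom))) in inj₁ j , a , p

    module _ (discrete : ¬ (∃[ A ] ∃[ B ] A ∈ C × B ∈ C × ¬ (A ≡ B) × Hom A B)) where

      hom⇒≡ : ∀ {A B} → A ∈ C → B ∈ C → Hom A B → A ≡ B
      hom⇒≡ A∈C B∈C h = byContradiction λ A≢B → discrete (_ , _ , A∈C , B∈C , A≢B , h)

      injective : ∀ {A B j} → A ∈ C → B ∈ C → Code A j → Code B j → A ≡ B
      injective {A} {B} {inj₁ j} A∈C B∈C (_ , p) (_ , q) =
        let D , D∈C , h = holds⁻ (lower (proj₁ (φ-defines (A ×ˢ B)) (j , disjunct-× φ j p q)))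
        in trans (sym (hom⇒≡ D∈C A∈C (π₁ {M = A} {B} ∘ʰ h)))
                 (hom⇒≡ D∈C B∈C (π₂ {M = A} {B} ∘ʰ h))
      injective {j = inj₂ _} A∈C B∈C (A-empty , p) (B-empty , q) =
        hom⇒≡ A∈C B∈C (homBetweenEmpty A-empty B-empty (trans p (sym q)))

  -- The formula given by a weakly initial family.

  module _ {ℓ} {I : Set ℓ} {B : I → Set ℓ} where

    -- Recovers from pooled variables or conjuncts those belonging to `j`.
    component : (j : I) → Σ[ i ∈ I ] B i → Maybe (B j)
    component j (i , b) with excludedMiddle {P = i ≡ j}
    ... | yes refl = just b
    ... | no  _    = nothing

    component-same : ∀ j b → component j (j , b) ≡ just b
    component-same j b with excludedMiddle {P = j ≡ j}
    ... | yes refl = refl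
    ... | no  j≢j  = contradiction refl j≢j

  module WeaklyInitialFamily {ℓ} {S : Signature ℓ} {P : SubsetAssignment S}
    (preserved : PreservedByHoms P) {I : Set ℓ} (u : I → Element P)
    (weaklyInitial : ∀ d → ∃[ i ] ElementHom P (u i) d) where

    structure : I → Structure S
    structure = proj₁ ∘ u

    marked : ∀ i → ∣ structure i ∣
    marked i = proj₁ (proj₂ (u i))

    -- The positive diagram of the marked structure: a valuation satisfying it is a homomorphism
    -- sending the marked element to the value of the free variable.
    data Fact (i : I) : Set ℓ where
      point    : Fact i
      function : (f : Func S) → Vector ∣ structure i ∣ (funcArity S f) → Fact i
      relation : (r : Rel S) (xs : Vector ∣ structure i ∣ (relArity S r)) →
                 T (rel (structure i) r xs) → Fact i

    -- The formula requires one index set for the variables and the conjuncts of all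
    -- disjuncts; the conjuncts that do not concern a disjunct are made trivial.
    Index : Set ℓ
    Index = (Σ[ i ∈ I ] ∣ structure i ∣) ⊎ (Σ[ i ∈ I ] Fact i)

    ⌜_⌝ : ∀ {i} → ∣ structure i ∣ → Term S (Maybe Index)
    ⌜ x ⌝ = var (just (inj₁ (_ , x)))

    trivial : Atomic S (Maybe Index)
    trivial = equation (var nothing) (var nothing)

    atom : ∀ {i} → Fact i → Atomic S (Maybe Index)
    atom {i} point         = equation ⌜ marked i ⌝ (var nothing)
    atom (function f xs)   = equation ⌜ func (structure _) f xs ⌝ (app f (⌜_⌝ ∘ xs))
    atom (relation r xs _) = relation r (⌜_⌝ ∘ xs)

    conjunct : I → Index → Atomic S (Maybe Index)
    conjunct j (inj₁ _) = trivial
    conjunct j (inj₂ c) = maybe′ atom trivial (component j c)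

    diagrams : CoherentFormula S
    diagrams = record { κ = Index ; Λ = I ; ψ = conjunct }

    diagrams-sound : ∀ M {a} → a ∈ ⟦ diagrams ⟧ M → a ∈ P M
    diagrams-sound M {a} (j , b , sat) =
      subst (_∈ P M) (fact point) (preserved h (proj₂ (proj₂ (u j))))
      where
      fact : ∀ c → Satisfies M (maybe′ b a) (atom {j} c)
      fact c = subst (Satisfies M (maybe′ b a))
                     (cong (maybe′ atom trivial) (component-same j c)) (sat (inj₂ (j , c)))

      h : Hom (structure j) M
      h = record
        { apply         = λ x → b (inj₁ (j , x))
        ; preservesFunc = λ f xs → fact (function f xs)
        ; preservesRel  = λ r xs t → lower (fact (relation r xs t))
        }

    diagrams-complete : ∀ M {a} → a ∈ P M → a ∈ ⟦ diagrams ⟧ M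
    diagrams-complete M {a} a∈P with weaklyInitial (M , a , a∈P)
    ... | j , h , ha≡a = j , b , sat
      where
      b : Index → ∣ M ∣
      -- Variables of other structures occur in no conjunct of disjunct `j`, so they may take the
      -- arbitrary value `a`.
      b (inj₁ v) = maybe′ (apply h) a (component j v)
      b (inj₂ _) = a

      b-h : ∀ x → b (inj₁ (j , x)) ≡ apply h x
      b-h x = cong (maybe′ (apply h) a) (component-same j x)

      sat-atom : (c : Fact j) → Satisfies M (maybe′ b a) (atom c)
      sat-atom point             = trans (b-h _) ha≡a
      sat-atom (function f xs)   = trans (b-h _) (trans (preservesFunc h f xs)
        (cong (func M f) (extensionality λ i → sym (b-h (xs i)))))
      sat-atom (relation r xs t) = lift
        (subst (T ∘ rel M r) (extensionality λ i → sym (b-h (xs i))) (preservesRel h r xs t))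

      sat-maybe : (c : Maybe (Fact j)) → Satisfies M (maybe′ b a) (maybe′ atom trivial c)
      sat-maybe (just c) = sat-atom c
      sat-maybe nothing  = refl

      sat : ∀ i → Satisfies M (maybe′ b a) (conjunct j i)
      sat (inj₁ _) = refl
      sat (inj₂ c) = sat-maybe (component j c)

  -- Linearity of the ordinals and canonical representatives.

  module _ {ℓ : Level} where

    -- If some `f i` is below no `g j`, then by induction every `g j` is strictly below `f i`,
    -- whence `sup g ≤ f i`.
    ≤⊎> : (α β : Ordinal ℓ) → α ≤ β ⊎ β < α
    ≤⊎> (sup f) (sup g) with excludedMiddle {P = ∃[ i ] (∀ j → ¬ (f i ≤ g j))}
    ... | no  ∄i      = inj₁ λ i →
      byContradiction λ ∄j → ∄i (i , λ j p → ∄j (j , p))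
    ... | yes (i , p) = inj₂ (i , sup-least (f i) λ j → above j (≤⊎> (f i) (g j)))
      where
      above : ∀ j → f i ≤ g j ⊎ g j < f i → g j < f i
      above j (inj₁ q) = contradiction q (p j)
      above j (inj₂ q) = q

    mutual

      -- By linearity, either `γ` is the ordinal of the root, or it lies below an immediate subtree,
      -- where the search continues.
      findNode : ∀ {γ} β → γ ≤ β → ∃[ s ] subtree β s ≈ γ
      findNode {γ} β γ≤β with ≤⊎> β γ
      ... | inj₁ β≤γ = nothing , β≤γ , γ≤β
      ... | inj₂ γ<β = let s , p = findProperNode β γ<β in just s , p

      findProperNode : ∀ {γ} β → γ < β → ∃[ s ] subtree β (just s) ≈ γ
      findProperNode (sup g) (j , γ≤gj) =
        let s , p = findNode (g j) γ≤gj in (j , s) , p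

    -- One tree for each `≈`-class, since `≈` does not give equal node sets. The default, zero, only
    -- makes the choice total.
    rep : Ordinal ℓ → Ordinal ℓ
    rep α = choose (sup {I = ⊥} λ ()) (λ β → holds (β ≈ α))

    rep-≈ : ∀ α → rep α ≈ α
    rep-≈ α = holds⁻ (choose-satisfies (sup {I = ⊥} λ ()) (λ β → holds (β ≈ α))
                        (α , holds⁺ (≤-refl α , ≤-refl α)))

    rep-cong : ∀ {α β} → α ≈ β → rep α ≡ rep β
    rep-cong α≈β = cong (choose _) (extensionality λ γ → holds-cong
      (mk⇔ (λ p → ≈-trans p α≈β) (λ p → ≈-trans p (≈-sym α≈β))))

  -- A transfinite sequence in which no term maps to a later one.

  module Chain {ℓ} {D : Set (suc ℓ)} (_↝_ : D → D → Set ℓ)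
    (avoidable : ∀ {I : Set ℓ} (u : I → D) → ∃[ d ] (∀ i → ¬ (u i ↝ d))) where

    -- Avoiding the empty family shows that `D` is inhabited, which supplies the default value.
    avoider : {I : Set ℓ} → (I → D) → D
    avoider u = choose (proj₁ (avoidable {I = ⊥} λ ())) (λ d → holds (∀ i → ¬ (u i ↝ d)))

    avoider-avoids : ∀ {I : Set ℓ} (u : I → D) i → ¬ (u i ↝ avoider u)
    avoider-avoids u =
      let d , p = avoidable u
      in holds⁻ (choose-satisfies _ (λ d → holds (∀ i → ¬ (u i ↝ d))) (d , holds⁺ p))

    -- Families with the same values are avoided by the same elements, so the two Boolean predicates
    -- are equal.
    avoider-cong : ∀ {I J : Set ℓ} {u : I → D} {v : J → D} →
      (∀ i → ∃[ j ] u i ≡ v j) → (∀ j → ∃[ i ] u i ≡ v j) → avoider u ≡ avoider v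
    avoider-cong {u = u} {v} u⊆v v⊆u =
      cong (choose _) (extensionality λ d → holds-cong (mk⇔
        (λ p j → let i , eq = v⊆u j in subst (λ e → ¬ (e ↝ d)) eq (p i))
        (λ p i → let j , eq = u⊆v i in subst (λ e → ¬ (e ↝ d)) (sym eq) (p j))))

    -- The term of the sequence at the ordinal `subtree α s`. Defining it at all nodes of `α`
    -- together makes the recursion structural and the family of earlier terms small.
    term : ∀ α → Node α → D
    term (sup f) nothing        = avoider {I = ProperNode (sup f)} λ (i , s) → term (f i) s
    term (sup f) (just (i , s)) = term (f i) s

    chain : Ordinal ℓ → D
    chain α = term α nothing

    term≡chain : ∀ α s → term α s ≡ chain (subtree α s)
    term≡chain (sup f) nothing        = refl
    term≡chain (sup f) (just (i , s)) = term≡chain (f i) s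

    -- The sequence depends only on ordinals, not on trees: proper nodes of equivalent trees carry
    -- the same ordinals, so by induction the families to be avoided have the same values.
    term-cong : ∀ α s β → subtree α s ≈ β → term α s ≡ chain β
    term-cong (sup f) (just (i , s)) β       p       = term-cong (f i) s β p
    term-cong (sup f) nothing        (sup g) (p , q) = avoider-cong
      (λ (i , s) →
        let t , r = findProperNode (sup g) (≤-<-trans (subtree-≤ (f i) s) (p i))
        in t , trans (term-cong (f i) s _ (≈-sym r)) (sym (term≡chain (sup g) (just t))))
      (λ (j , t) →
        let (i , s) , r = findProperNode (sup f) (≤-<-trans (subtree-≤ (g j) t) (q j))
        in (i , s) , trans (term-cong (f i) s _ r) (sym (term≡chain (g j) t)))

    chain-avoids : ∀ {α β} → α < β → ¬ (chain α ↝ chain β)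
    chain-avoids {α} {sup g} α<β h =
      let s , p = findProperNode (sup g) α<β
      in avoider-avoids _ s
           (subst (_↝ chain (sup g)) (sym (term-cong (sup g) (just s) α p)) h)

  -- Adjoining an ordinal to a marked structure.

  module _ {ℓ} {S : Signature ℓ} where

    -- The nodes stand in for the ordinals up to `α`; nodes carrying equivalent ordinals are left
    -- unrelated by `order`.
    Holds : (M : Structure S) → ∣ M ∣ → (α : Ordinal ℓ) (r : Symbol S) →
            Vector (∣ M ∣ ⊎ Node α) (relArity (expandedSignature S) r) → Set ℓ
    Holds M a α element      v = ∃[ x ] v ≡ const (inj₁ x)
    Holds M a α point        v = v ≡ const (inj₁ a)
    Holds M a α node         v = ∃[ s ] v ≡ const (inj₂ s)
    Holds M a α order        v =
      ∃[ s ] ∃[ t ] subtree α s < subtree α t × v ≡ map inj₂ (s ∷ t ∷ [])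
    Holds M a α (graph f)    v = ∃[ xs ] v ≡ map inj₁ (func M f xs ∷ xs)
    Holds M a α (original r) v = ∃[ xs ] T (rel M r xs) × v ≡ map inj₁ xs

    expand : (M : Structure S) → ∣ M ∣ → Ordinal ℓ → Structure (expandedSignature S)
    expand M a α = record
      { ∣_∣ = ∣ M ∣ ⊎ Node α ; func = λ () ; rel = λ r v → holds (Holds M a α r v) }

    module _ {M N : Structure S} {a b} {α β : Ordinal ℓ}
      (h : Hom (expand M a α) (expand N b β)) where

      preservesHolds : ∀ r v → Holds M a α r v → Holds N b β r (map (apply h) v)
      preservesHolds r v p = holds⁻ (preservesRel h r v (holds⁺ p))

      restrict-element : ∀ x → ∃[ y ] apply h (inj₁ x) ≡ inj₁ y
      restrict-element x =
        let y , eq = preservesHolds element (const (inj₁ x)) (x , refl)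
        in y , cong-app eq zero

      restrict-node : ∀ s → ∃[ t ] apply h (inj₂ s) ≡ inj₂ t
      restrict-node s =
        let t , eq = preservesHolds node (const (inj₂ s)) (s , refl)
        in t , cong-app eq zero

      onElements : ∣ M ∣ → ∣ N ∣
      onElements = proj₁ ∘ restrict-element

      onNodes : Node α → Node β
      onNodes = proj₁ ∘ restrict-node

      onElements-≡ : ∀ {x y} → apply h (inj₁ x) ≡ inj₁ y → onElements x ≡ y
      onElements-≡ {x} eq = inj₁-injective (trans (sym (proj₂ (restrict-element x))) eq)

      onNodes-≡ : ∀ {s t} → apply h (inj₂ s) ≡ inj₂ t → onNodes s ≡ t
      onNodes-≡ {s} eq = inj₂-injective (trans (sym (proj₂ (restrict-node s))) eq)

      restrict : Hom M N
      restrict = record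
        { apply         = onElements
        ; preservesFunc = λ f xs →
            -- Entry `zero` of `eq` is the image of the value; the later entries are the images of
            -- the arguments.
            let ys , eq = preservesHolds (graph f) _ (xs , refl)
            in trans (onElements-≡ (cong-app eq zero))
                     (cong (func N f) (extensionality λ i →
                       sym (onElements-≡ (cong-app eq (Fin.suc i)))))
        ; preservesRel  = λ r xs t →
            let ys , t′ , eq = preservesHolds (original r) _ (xs , t , refl)
            in subst (T ∘ rel N r) (extensionality λ i →
                 sym (onElements-≡ (cong-app eq i))) t′
        }

      restrict-point : apply restrict a ≡ b
      restrict-point = onElements-≡ (cong-app (preservesHolds point _ refl) zero)

      onNodes-monotone : ∀ s t → subtree α s < subtree α t →
                         subtree β (onNodes s) < subtree β (onNodes t)
      onNodes-monotone s t p with preservesHolds order _ (s , t , p , refl)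
      ... | s′ , t′ , p′ , eq
        rewrite onNodes-≡ (cong-app eq zero) | onNodes-≡ (cong-app eq (Fin.suc zero)) = p′

      -- The map on nodes is strictly increasing, so the image of the root carries an ordinal that
      -- is at least `α`.
      ordinal-≤ : α ≤ β
      ordinal-≤ = ≤-trans (≤-monotone-root α (subtree β ∘ onNodes) onNodes-monotone)
                          (subtree-≤ β (onNodes nothing))

  -- From Vopěnka's principle to definability.

  module _ {ℓ} (vopěnka : VopěnkaPrinciple ℓ) {S : Signature ℓ} (P : SubsetAssignment S) where

    unavoidable : ¬ (∀ {I : Set ℓ} (u : I → Element P) → ∃[ d ] (∀ i → ¬ ElementHom P (u i) d))
    unavoidable avoidable = impossible (vopěnka _ C proper)
      where
      open Chain (ElementHom P) avoidable

      -- Built from `rep α` so that equivalent ordinals give equal structures, as distinctness of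
      -- members requires.
      F : Ordinal ℓ → Structure (expandedSignature S)
      F α = let M , a , _ = chain (rep α) in expand M a (rep α)

      F-≤ : ∀ {α β} → Hom (F α) (F β) → α ≤ β
      F-≤ {α} {β} h =
        ≤-trans (proj₂ (rep-≈ α)) (≤-trans (ordinal-≤ h) (proj₁ (rep-≈ β)))

      F-≮ : ∀ {α β} → α < β → ¬ Hom (F α) (F β)
      F-≮ {α} {β} α<β h = chain-avoids
        (≤-<-trans (proj₁ (rep-≈ α)) (<-≤-trans α<β (proj₂ (rep-≈ β))))
        (restrict h , restrict-point h)

      C : Pred (Structure (expandedSignature S)) (suc ℓ)
      C A = ∃[ α ] A ≡ F α

      -- The Burali-Forti argument: `α` lies strictly above every `index i`, yet `F α` equals some
      -- `F (index i)`, which forces `α ≤ index i`.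
      proper : ProperClass C
      proper (I , u , C⊆u , u⊆C) =
        let i , ui≡Fα = C⊆u (α , refl)
            α≤index   = F-≤ (subst (Hom (F α)) (trans (sym ui≡Fα) (ui≡F i)) idHom)
        in <-irrefl {α = α} (i , α≤index)
        where
        index : I → Ordinal ℓ
        index i = proj₁ (u⊆C (i , refl))

        ui≡F : ∀ i → u i ≡ F (index i)
        ui≡F i = proj₂ (u⊆C (i , refl))

        α : Ordinal ℓ
        α = sup index

      impossible : ¬ (∃[ A ] ∃[ B ] A ∈ C × B ∈ C × ¬ (A ≡ B) × Hom A B)
      impossible (_ , _ , (α , refl) , (β , refl) , A≢B , h) with ≤⊎> β α
      ... | inj₂ α<β = F-≮ α<β h
      -- The homomorphism gives `α ≤ β`, so both structures come from the same representative.
      ... | inj₁ β≤α = A≢B (cong (λ γ → let M , a , _ = chain γ in expand M a γ)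
                                 (rep-cong (F-≤ h , β≤α)))

    weaklyInitialFamily :
      Σ[ I ∈ Set ℓ ] Σ[ u ∈ (I → Element P) ] (∀ d → ∃[ i ] ElementHom P (u i) d)
    weaklyInitialFamily = byContradiction λ none → unavoidable λ {I} u →
      byContradiction λ ∄d → none (I , u , λ d →
        byContradiction λ ∄i → ∄d (d , λ i h → ∄i (i , h)))

  vopěnka⇒definable : ∀ {ℓ} → VopěnkaPrinciple ℓ → PreservedSubsetsDefinable ℓ
  vopěnka⇒definable vopěnka S P preserved =
    let _ , u , weaklyInitial = weaklyInitialFamily vopěnka P
        open WeaklyInitialFamily preserved u weaklyInitial
    in diagrams , λ M → diagrams-sound M , diagrams-complete M

theorem4 : ∀ ℓ → Classical → VopěnkaPrinciple ℓ ⇔ PreservedSubsetsDefinable ℓ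
theorem4 ℓ classical = mk⇔ (vopěnka⇒definable classical) (definable⇒vopěnka classical)
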